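{- Let $k\ge 1$, let $\mathcal{G} = (\mathcal{A},\mathrm{GenReach}(F_1,\ldots,F_k))$ be a generalized reachability game, and let $v_0$ be a starting vertex. (1) If Eve wins from $v_0$, then she has a winning strategy from $v_0$ that uses a memory structure with $2^k-1$ memory states. (2) If Adam wins from $v_0$, then he has a winning strategy from $v_0$ that uses a memory structure with $\binom{k}{\lfloor k/2\rfloor}$ memory states.
   Context: An arena $\mathcal{A} = (V,(V_\circ,V_\Box),E)$ consists of a finite directed graph $(V,E)$, in which every vertex has at least one outgoing edge, and a partition $(V_\circ,V_\Box)$ of $V$: vertices in $V_\circ$ are controlled by Eve, vertices in $V_\Box$ by Adam. A play is an infinite path $\pi = v_0,v_1,v_2,\ldots$ in the graph. A strategy for Eve is a function $\sigma : V^*\cdot V_\circ \to V$ with $(v,\sigma(w\cdot v))\in E$ for all $w \in V^*$, $v \in V_\circ$; strategies $\tau$ for Adam are defined similarly with $V_\Box$. A starting vertex $v_0$ and strategies $\sigma,\tau$ determine a unique play $\pi(v_0,\sigma,\tau)$. A game is a pair $(\mathcal{A},\Phi)$ with $\Phi$ a set of plays; Eve wins a play iff it belongs to $\Phi$, and Adam wins it otherwise. A strategy $\sigma$ of Eve is winning from $v_0$ if $\pi(v_0,\sigma,\tau)\in\Phi$ for every strategy $\tau$ of Adam; a strategy $\tau$ of Adam is winning from $v_0$ if $\pi(v_0,\sigma,\tau)\notin\Phi$ for every strategy $\sigma$ of Eve. A player wins from $v_0$ if he or she has a winning strategy from $v_0$. Given subsets $F_1,\ldots,F_k \subseteq V$,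 the generalized reachability objective is $$\mathrm{GenReach}(F_1,\ldots,F_k) = \{ v_0,v_1,v_2,\ldots \mid \forall i\in\{1,\ldots,k\},\ \exists p_i\in\mathbb{N},\ v_{p_i}\in F_i\}.$$ A generalized reachability game is a game of the form $(\mathcal{A},\mathrm{GenReach}(F_1,\ldots,F_k))$. A memory structure $\mathcal{M}=(M,m_0,\mu)$ for $\mathcal{A}$ consists of a set $M$ of memory states, an initial memory state $m_0\in M$, and an update function $\mu: M\times E\to M$. It is extended to $\mu^*:V^+\to M$ (on finite paths) by $\mu^*(v)=m_0$ and $\mu^*(w\cdot u\cdot v)=\mu(\mu^*(w\cdot u),(u,v))$. A strategy for Eve uses the memory structure $\mathcal{M}$ if it is given by a next-move function $\nu: V_\circ\times M\to V$ via $\sigma(w\cdot v)=\nu(v,\mu^*(w\cdot v))$; similarly for Adam with $V_\Box$ in place of $V_\circ$. The number of memory states is $|M|$. The memory structure may depend on the starting vertex $v_0$. -}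

module Defs where

open import Data.Fin.Base using (Fin)
open import Data.Fin.Subset using (Subset; _∈_; Nonempty)
open import Data.List.Base using (List; []; _∷ʳ_)
open import Data.Nat.Base using (ℕ; zero; suc)
open import Data.Product.Base using (Σ-syntax; ∃-syntax; _×_; _,_; proj₁; proj₂)
open import Function.Bundles using (_↔_)
open import Relation.Binary.PropositionalEquality using (_≡_; refl)
open import Relation.Nullary.Negation using (¬_)

data Player : Set where
  Eve Adam : Player

-- The partition of the vertices is given by the function `owner`: the
-- vertices controlled by p are those v with owner v ≡ p.
record Arena (n : ℕ) : Set where
  field
    successors   : Fin n → Subset n
    hasSuccessor : ∀ v → Nonempty (successors v)
    owner        : Fin n → Player

  V : Set
  V = Fin n

  Edge : V → V → Set
  Edge u v = v ∈ successors u

  E : Set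
  E = Σ[ u ∈ V ] Σ[ v ∈ V ] Edge u v

module _ {n : ℕ} (A : Arena n) where
  open Arena A

  record Play : Set where
    field
      vertex : ℕ → V
      edge   : ∀ i → Edge (vertex i) (vertex (suc i))

  -- A nonempty word w · v is split into its prefix w, in chronological
  -- order, and its last letter v.
  record Strategy (p : Player) : Set where
    field
      move  : (w : List V) (v : V) → owner v ≡ p → V
      legal : ∀ w v (own : owner v ≡ p) → Edge v (move w v own)

  module _ (v₀ : V) (σ : Strategy Eve) (τ : Strategy Adam) where
    open Strategy

    choice : (w : List V) (v : V) (p : Player) → owner v ≡ p → ∃[ u ] Edge v u
    choice w v Eve  own = move σ w v own , legal σ w v own
    choice w v Adam own = move τ w v own , legal τ w v own

    next : (w : List V) (v : V) → ∃[ u ] Edge v u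
    next w v = choice w v (owner v) refl

    -- (v₀ ⋯ vᵢ₋₁ , vᵢ)
    history : ℕ → List V × V
    history zero    = [] , v₀
    history (suc i) = let (w , v) = history i in w ∷ʳ v , proj₁ (next w v)

    play : Play
    play = record
      { vertex = λ i → proj₂ (history i)
      ; edge   = λ i → let (w , v) = history i in proj₂ (next w v)
      }

  -- Path w v: the word w · v is a finite path.
  data Path : List V → V → Set where
    start  : (v : V) → Path [] v
    extend : ∀ {w u v} → Path w u → Edge u v → Path (w ∷ʳ u) v

  record MemoryStructure : Set₁ where
    field
      M  : Set
      m₀ : M
      μ  : M → E → M

    μ* : ∀ {w v} → Path w v → M
    μ* (start v)                = m₀
    μ* (extend {u = u} {v} π e) = μ (μ* π) (u , v , e)

  -- As μ* is defined on finite paths only, so is the constraint on σ.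
  UsesMemory : ∀ {p} → Strategy p → MemoryStructure → Set
  UsesMemory {p} σ 𝓜 =
    Σ[ ν ∈ ((v : V) → owner v ≡ p → M → V) ]
      (∀ {w v} (π : Path w v) (own : owner v ≡ p) →
        Strategy.move σ w v own ≡ ν v own (μ* π))
    where open MemoryStructure 𝓜

  HasStates : MemoryStructure → ℕ → Set
  HasStates 𝓜 m = MemoryStructure.M 𝓜 ↔ Fin m

  GenReach : ∀ {k} → (Fin k → Subset n) → Play → Set
  GenReach F π = ∀ i → ∃[ j ] Play.vertex π j ∈ F i

record Game (n : ℕ) : Set₁ where
  field
    arena : Arena n
    Φ     : Play arena → Set

genReachGame : ∀ {n k} → Arena n → (Fin k → Subset n) → Game n
genReachGame A F = record { arena = A ; Φ = GenReach A F }

module _ {n : ℕ} (G : Game n) where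
  open Game G

  Winning : (p : Player) → Fin n → Strategy arena p → Set
  Winning Eve  v₀ σ = (τ : Strategy arena Adam) → Φ (play arena v₀ σ τ)
  Winning Adam v₀ τ = (σ : Strategy arena Eve) → ¬ Φ (play arena v₀ σ τ)

  Wins : Player → Fin n → Set
  Wins p v₀ = ∃[ σ ] Winning p v₀ σ

  WinsWithMemory : Player → Fin n → ℕ → Set₁
  WinsWithMemory p v₀ m =
    Σ[ 𝓜 ∈ MemoryStructure arena ] HasStates arena 𝓜 m ×
      (∃[ σ ] Winning p v₀ σ × UsesMemory arena σ 𝓜)

{-# OPTIONS --safe #-}

-- Record which targets remain to be visited.  Eve wins from v with remaining set S
-- iff she can force a visit to all of S within some number of moves, and this
-- attractor stabilises at a stage N.  Hence exactly one of two positional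
-- strategies of the product game wins, and the other player cannot win at all.
--
-- Eve's strategy remembers the remaining set, which only matters while nonempty.
--
-- The sets S from which Adam escapes at v are upward closed, so a lower estimate of
-- the remaining set from which he still escapes suffices as memory.  Partition the
-- subsets of the k targets into k C ⌊k/2⌋ chains.  Adam only remembers a chain and
-- believes in the least set in it from which he escapes at the current vertex.

module Submission where

open import Defs
open import Algebra.Properties.CommutativeSemigroup using (interchange)
open import Data.Bool.Base using (true; false)
open import Data.Fin.Base using (Fin; zero; suc; _↑ˡ_; _↑ʳ_; splitAt; combine; remQuot; funToFin; finToFun; punchIn; punchOut)
open import Data.Fin.Properties using (_≟_; any?; all?; 2↔Bool; splitAt-↑ˡ; splitAt-↑ʳ; remQuot-combine; finToFun-funToFin; punchIn-punchOut)
open import Data.Fin.Subset using (Subset; _∈_; _∉_; _⊆_; _⊂_; _⊃_; _─_; ⊤; ⊥; Nonempty; Empty)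
open import Data.Fin.Subset.Induction using (⊂-wellFounded; ⊃-wellFounded)
open import Data.Fin.Subset.Properties using (_∈?_; _⊂?_; nonempty?; anySubset?; ∈⊤; ∉⊥; x∈p∧x∉q⇒x∈p─q; p─q⊆p; ⊆-refl; ⊆-trans; in⊆in; out⊆)
open import Data.Integer.Base using (ℤ; +_; -[1+_]) renaming (suc to sucℤ; pred to predℤ)
open import Data.Integer.Properties using (suc-pred; pred-suc)
open import Data.List.Base using (List; foldl)
open import Data.List.Properties using (foldl-∷ʳ)
open import Data.Nat.Base using (ℕ; zero; suc; _+_; _*_; _≤_; _<_; _^_; _∸_; _⊔_; ⌊_/2⌋; z≤n; s≤s)
open import Data.Nat.Combinatorics using (_C_; nCk+nC[k+1]≡[n+1]C[k+1])
open import Data.Nat.Induction using (<-wellFounded)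
open import Data.Nat.Properties using (+-comm; +-assoc; +-cancelʳ-≡; +-commutativeSemigroup; ≤-refl; ≤-trans; <⇒≤; m≤n⇒m≤1+n; m≤m⊔n; m≤n⊔m; m≤n⇒m<n∨m≡n; ^-monoʳ-≤)
open import Data.Product.Base using (Σ-syntax; ∃-syntax; _×_; _,_; proj₁; proj₂; uncurry; map₂)
open import Data.Sum.Base using (_⊎_; inj₁; inj₂)
open import Data.Vec.Base using ([]; _∷_; there; lookup; tabulate)
open import Data.Vec.Properties using (lookup∘tabulate; tabulate∘lookup; tabulate-cong; []=⇒lookup; lookup⇒[]=)
open import Function.Base using (_∘_)
open import Function.Bundles using (Inverse)
open import Function.Construct.Identity using (↔-id)
open import Induction.WellFounded using (Acc; acc)
open import Relation.Binary.PropositionalEquality using (_≡_; refl; sym; trans; cong; cong₂; subst; subst-sym-subst; module ≡-Reasoning)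
open import Relation.Nullary using (¬_; Dec; yes; no; does; contradiction; _×-dec_; _⊎-dec_; ¬?; decidable-stable)
open import Relation.Nullary.Decidable using (_→-dec_; dec-true)
open import Relation.Unary using (Decidable)

-- Chain decomposition of the lattice of subsets

-- Walks with steps ±1 from height h that never become negative.
data Ballot : ℕ → ℕ → Set where
  end  : ∀ {h} → Ballot zero h
  up   : ∀ {k h} → Ballot k (suc h) → Ballot (suc k) h
  down : ∀ {k h} → Ballot k h → Ballot (suc k) (suc h)

-- Read a subset as a word of brackets, true opening and false closing.  Here h
-- counts the open brackets and g ≥ h in addition the unmatched closing brackets
-- read so far, which are turned into opening ones.  Two words with the same image
-- have the same matched pairs, and the unmatched letters of a word have the form
-- false ⋯ false true ⋯ true; so the fibres are the chains of Greene and Kleitman.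
bracketing : ∀ {k} h g → h ≤ g → Subset k → Ballot k g
bracketing h       g       h≤g       []          = end
bracketing h       g       h≤g       (true  ∷ S) = up (bracketing (suc h) (suc g) (s≤s h≤g) S)
bracketing zero    g       h≤g       (false ∷ S) = up (bracketing zero (suc g) z≤n S)
bracketing (suc h) (suc g) (s≤s h≤g) (false ∷ S) = down (bracketing h g h≤g S)

up-injective : ∀ {k h} {w w′ : Ballot k (suc h)} → up w ≡ up w′ → w ≡ w′
up-injective refl = refl

down-injective : ∀ {k h} {w w′ : Ballot k h} → down w ≡ down w′ → w ≡ w′
down-injective refl = refl

-- The surplus `h < h′` persists, so `T` always has an open bracket. A `false` in `T` thus gives
-- `down` and forces `false` in `S`; the words differ only where an unmatched `false` of `S` meets a
-- `true` of `T`.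
bracketing-< : ∀ {k} {h h′ g} (p : h ≤ g) (p′ : h′ ≤ g) (S T : Subset k) → h < h′ →
  bracketing h g p S ≡ bracketing h′ g p′ T → S ⊆ T
bracketing-< p p′ [] [] h<h′ eq = ⊆-refl
bracketing-< p p′ (true ∷ S) (true ∷ T) h<h′ eq =
  in⊆in (bracketing-< _ _ S T (s≤s h<h′) (up-injective eq))
bracketing-< {h = zero} p p′ (false ∷ S) (true ∷ T) h<h′ eq =
  out⊆ (bracketing-< _ _ S T (s≤s z≤n) (up-injective eq))
bracketing-< {h = suc h} (s≤s p) p′ (false ∷ S) (true ∷ T) h<h′ ()
bracketing-< {h′ = suc h′} p (s≤s p′) (true ∷ S) (false ∷ T) h<h′ ()
bracketing-< {h = zero} {suc h′} p (s≤s p′) (false ∷ S) (false ∷ T) h<h′ ()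
bracketing-< {h = suc h} {suc h′} (s≤s p) (s≤s p′) (false ∷ S) (false ∷ T) (s≤s h<h′) eq =
  out⊆ (bracketing-< p p′ S T h<h′ (down-injective eq))

-- The words agree until an unmatched `false` of one meets a `true` of the other. From there on the
-- latter has more open brackets, and `bracketing-<` applies.
bracketing-comparable : ∀ {k} {h g} (p p′ : h ≤ g) (S T : Subset k) →
  bracketing h g p S ≡ bracketing h g p′ T → S ⊆ T ⊎ T ⊆ S
bracketing-comparable p p′ [] [] eq = inj₁ ⊆-refl
bracketing-comparable p p′ (true ∷ S) (true ∷ T) eq
  with bracketing-comparable _ _ S T (up-injective eq)
... | inj₁ S⊆T = inj₁ (in⊆in S⊆T)
... | inj₂ T⊆S = inj₂ (in⊆in T⊆S)
bracketing-comparable {h = zero} p p′ (false ∷ S) (true ∷ T) eq =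
  inj₁ (out⊆ (bracketing-< _ _ S T (s≤s z≤n) (up-injective eq)))
bracketing-comparable {h = zero} p p′ (true ∷ S) (false ∷ T) eq =
  inj₂ (out⊆ (bracketing-< _ _ T S (s≤s z≤n) (sym (up-injective eq))))
bracketing-comparable {h = suc h} (s≤s p) p′ (false ∷ S) (true ∷ T) ()
bracketing-comparable {h = suc h} p (s≤s p′) (true ∷ S) (false ∷ T) ()
bracketing-comparable {h = zero} p p′ (false ∷ S) (false ∷ T) eq
  with bracketing-comparable _ _ S T (up-injective eq)
... | inj₁ S⊆T = inj₁ (out⊆ S⊆T)
... | inj₂ T⊆S = inj₂ (out⊆ T⊆S)
bracketing-comparable {h = suc h} (s≤s p) (s≤s p′) (false ∷ S) (false ∷ T) eq
  with bracketing-comparable _ _ S T (down-injective eq)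
... | inj₁ S⊆T = inj₁ (out⊆ S⊆T)
... | inj₂ T⊆S = inj₂ (out⊆ T⊆S)

-- Counting the ballot walks

#ballots : ℕ → ℕ → ℕ
#ballots zero    h       = 1
#ballots (suc k) zero    = #ballots k 1
#ballots (suc k) (suc h) = #ballots k h + #ballots k (suc (suc h))

index : ∀ {k h} → Ballot k h → Fin (#ballots k h)
index end                      = zero
index {suc k} {zero}  (up w)   = index w
index {suc k} {suc h} (up w)   = #ballots k h ↑ʳ index w
index {suc k} {suc h} (down w) = index w ↑ˡ #ballots k (suc (suc h))

unindex : ∀ {k h} → Fin (#ballots k h) → Ballot k h
unindex {zero}          i = end
unindex {suc k} {zero}  i = up (unindex i)
unindex {suc k} {suc h} i with splitAt (#ballots k h) i
... | inj₁ j = down (unindex j)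
... | inj₂ j = up (unindex j)

-- Makes `index` injective, so that equal chain numbers mean equal bracketings.
unindex-index : ∀ {k h} (w : Ballot k h) → unindex (index w) ≡ w
unindex-index end = refl
unindex-index {suc k} {zero}  (up w)   = cong up (unindex-index w)
unindex-index {suc k} {suc h} (up w)
  rewrite splitAt-↑ʳ (#ballots k h) (#ballots k (suc (suc h))) (index w) = cong up (unindex-index w)
unindex-index {suc k} {suc h} (down w)
  rewrite splitAt-↑ˡ (#ballots k h) (index w) (#ballots k (suc (suc h))) = cong down (unindex-index w)

-- The number of ±1-walks with k steps and sum at most z, respectively sum z or z − 1.
#walks≤ #walks≈ : ℕ → ℤ → ℕ
#walks≤ zero    (+ a)    = 1
#walks≤ zero    -[1+ a ] = 0
#walks≤ (suc k) z        = #walks≤ k (predℤ z) + #walks≤ k (sucℤ z)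
#walks≈ zero    (+ zero)          = 1
#walks≈ zero    (+ suc zero)      = 1
#walks≈ zero    (+ suc (suc a))   = 0
#walks≈ zero    -[1+ a ]          = 0
#walks≈ (suc k) z                 = #walks≈ k (predℤ z) + #walks≈ k (sucℤ z)

-- A walk that becomes negative is reflected from its first visit to −1 on.
reflection : ∀ k h → #ballots k h + #walks≤ k -[1+ suc h ] ≡ #walks≤ k (+ h)
reflection zero    h       = refl
reflection (suc k) zero    = begin
  #ballots k 1 + (#walks≤ k -[1+ 2 ] + #walks≤ k -[1+ 0 ]) ≡⟨ +-assoc (#ballots k 1) _ _ ⟨
  #ballots k 1 + #walks≤ k -[1+ 2 ] + #walks≤ k -[1+ 0 ]   ≡⟨ cong (_+ #walks≤ k -[1+ 0 ]) (reflection k 1) ⟩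
  #walks≤ k (+ 1) + #walks≤ k -[1+ 0 ]                     ≡⟨ +-comm (#walks≤ k (+ 1)) _ ⟩
  #walks≤ k -[1+ 0 ] + #walks≤ k (+ 1)                     ∎
  where open ≡-Reasoning
reflection (suc k) (suc h) = begin
  (b + b′) + (#walks≤ k -[1+ suc (suc (suc h)) ] + #walks≤ k -[1+ suc h ]) ≡⟨ cong (λ x → (b + b′) + x) (+-comm _ (#walks≤ k -[1+ suc h ])) ⟩
  (b + b′) + (#walks≤ k -[1+ suc h ] + #walks≤ k -[1+ suc (suc (suc h)) ]) ≡⟨ interchange +-commutativeSemigroup b b′ _ _ ⟩
  (b + #walks≤ k -[1+ suc h ]) + (b′ + #walks≤ k -[1+ suc (suc (suc h)) ]) ≡⟨ cong₂ _+_ (reflection k h) (reflection k (suc (suc h))) ⟩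
  #walks≤ k (+ h) + #walks≤ k (+ suc (suc h))                              ∎
  where
  open ≡-Reasoning
  b b′ : ℕ
  b  = #ballots k h
  b′ = #ballots k (suc (suc h))

#walks≤-split : ∀ k z → #walks≤ k z ≡ #walks≈ k z + #walks≤ k (predℤ (predℤ z))
#walks≤-split zero (+ zero)          = refl
#walks≤-split zero (+ suc zero)      = refl
#walks≤-split zero (+ suc (suc a))   = refl
#walks≤-split zero -[1+ a ]          = refl
#walks≤-split (suc k) z = begin
  #walks≤ k (predℤ z) + #walks≤ k (sucℤ z)
    ≡⟨ cong₂ _+_ (#walks≤-split k (predℤ z)) (#walks≤-split k (sucℤ z)) ⟩
  (#walks≈ k (predℤ z) + #walks≤ k (predℤ (predℤ (predℤ z)))) + (#walks≈ k (sucℤ z) + #walks≤ k (predℤ (predℤ (sucℤ z))))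
    ≡⟨ interchange +-commutativeSemigroup (#walks≈ k (predℤ z)) _ _ _ ⟩
  (#walks≈ k (predℤ z) + #walks≈ k (sucℤ z)) + (#walks≤ k (predℤ (predℤ (predℤ z))) + #walks≤ k (predℤ (predℤ (sucℤ z))))
    ≡⟨ cong (λ y → (#walks≈ k (predℤ z) + #walks≈ k (sucℤ z)) + (#walks≤ k (predℤ (predℤ (predℤ z))) + #walks≤ k y))
         (trans (cong predℤ (pred-suc z)) (sym (suc-pred (predℤ z)))) ⟩
  (#walks≈ k (predℤ z) + #walks≈ k (sucℤ z)) + (#walks≤ k (predℤ (predℤ (predℤ z))) + #walks≤ k (sucℤ (predℤ (predℤ z))))
    ∎
  where open ≡-Reasoning

infixl 6 _⊝_

-- Iterated predecessor, to match the shifts by `predℤ` and `sucℤ` in the recursion of `#walks≈`.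
_⊝_ : ℤ → ℕ → ℤ
z ⊝ zero  = z
z ⊝ suc k = predℤ (z ⊝ k)

predℤ-⊝ : ∀ z k → predℤ z ⊝ k ≡ predℤ (z ⊝ k)
predℤ-⊝ z zero    = refl
predℤ-⊝ z (suc k) = cong predℤ (predℤ-⊝ z k)

+k⊝k≡0 : ∀ k → + k ⊝ k ≡ + 0
+k⊝k≡0 zero    = refl
+k⊝k≡0 (suc k) = trans (sym (predℤ-⊝ (+ suc k) k)) (+k⊝k≡0 k)

#walks≈-step : ∀ k z → #walks≈ (suc k) (z ⊝ suc k) ≡ #walks≈ k (predℤ (predℤ z) ⊝ k) + #walks≈ k (z ⊝ k)
#walks≈-step k z = cong₂ (λ x y → #walks≈ k x + #walks≈ k y)
  (trans (cong predℤ (sym (predℤ-⊝ z k))) (sym (predℤ-⊝ (predℤ z) k))) (suc-pred (z ⊝ k))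

#walks≈-negative : ∀ k a → #walks≈ k (-[1+ a ] ⊝ k) ≡ 0
#walks≈-negative zero    a = refl
#walks≈-negative (suc k) a = trans (#walks≈-step k -[1+ a ])
  (cong₂ _+_ (#walks≈-negative k (suc (suc a))) (#walks≈-negative k a))

-- A walk with j steps +1 has sum 2j - k, so a sum of a - k or a - k - 1 means j = ⌊a/2⌋.
#walks≈-binomial : ∀ k a → #walks≈ k (+ a ⊝ k) ≡ k C ⌊ a /2⌋
#walks≈-binomial zero zero          = refl
#walks≈-binomial zero (suc zero)    = refl
#walks≈-binomial zero (suc (suc a)) = refl
#walks≈-binomial (suc k) zero       = trans (#walks≈-step k (+ 0))
  (cong₂ _+_ (#walks≈-negative k 1) (#walks≈-binomial k 0))
#walks≈-binomial (suc k) (suc zero) = trans (#walks≈-step k (+ 1))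
  (cong₂ _+_ (#walks≈-negative k 0) (#walks≈-binomial k 1))
#walks≈-binomial (suc k) (suc (suc a)) = begin
  #walks≈ (suc k) (+ suc (suc a) ⊝ suc k)             ≡⟨ #walks≈-step k (+ suc (suc a)) ⟩
  #walks≈ k (+ a ⊝ k) + #walks≈ k (+ suc (suc a) ⊝ k) ≡⟨ cong₂ _+_ (#walks≈-binomial k a) (#walks≈-binomial k (suc (suc a))) ⟩
  k C ⌊ a /2⌋ + k C suc ⌊ a /2⌋                       ≡⟨ nCk+nC[k+1]≡[n+1]C[k+1] k ⌊ a /2⌋ ⟩
  suc k C suc ⌊ a /2⌋                                 ∎
  where open ≡-Reasoning

-- The walks with sum at most -2 cancel between reflection and splitting; those with sum 0 or -1
-- remain.
#ballots≡C : ∀ k → #ballots k 0 ≡ k C ⌊ k /2⌋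
#ballots≡C k = +-cancelʳ-≡ (#walks≤ k -[1+ 1 ]) _ _ (begin
  #ballots k 0 + #walks≤ k -[1+ 1 ]       ≡⟨ reflection k 0 ⟩
  #walks≤ k (+ 0)                         ≡⟨ #walks≤-split k (+ 0) ⟩
  #walks≈ k (+ 0) + #walks≤ k -[1+ 1 ]    ≡⟨ cong (λ z → #walks≈ k z + #walks≤ k -[1+ 1 ]) (+k⊝k≡0 k) ⟨
  #walks≈ k (+ k ⊝ k) + #walks≤ k -[1+ 1 ] ≡⟨ cong (_+ #walks≤ k -[1+ 1 ]) (#walks≈-binomial k k) ⟩
  k C ⌊ k /2⌋ + #walks≤ k -[1+ 1 ]        ∎)
  where open ≡-Reasoning

chainDecomposition : ∀ k →
  Σ[ chain ∈ (Subset k → Fin (k C ⌊ k /2⌋)) ] (∀ S T → chain S ≡ chain T → S ⊆ T ⊎ T ⊆ S)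
chainDecomposition k =
  subst (λ m → Σ[ chain ∈ (Subset k → Fin m) ] (∀ S T → chain S ≡ chain T → S ⊆ T ⊎ T ⊆ S))
    (#ballots≡C k)
    ( (λ S → index (bracketing 0 0 z≤n S))
    , λ S T eq → bracketing-comparable z≤n z≤n S T
        (trans (sym (unindex-index _)) (trans (cong unindex eq) (unindex-index _))))

-- Finite sets

setOf : ∀ {m} {P : Fin m → Set} → Decidable P → Subset m
setOf P? = tabulate (does ∘ P?)

module _ {m : ℕ} {P : Fin m → Set} (P? : Decidable P) where

  ∈-setOf⁺ : ∀ {x} → P x → x ∈ setOf P?
  ∈-setOf⁺ {x} Px = lookup⇒[]= x _ (trans (lookup∘tabulate _ x) (dec-true (P? x) Px))

  ∈-setOf⁻ : ∀ {x} → x ∈ setOf P? → P x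
  ∈-setOf⁻ {x} x∈ with P? x | trans (sym (lookup∘tabulate (does ∘ P?) x)) ([]=⇒lookup x∈)
  ... | yes Px | _ = Px

x∈p─q⇒x∉q : ∀ {m} (p q : Subset m) {x} → x ∈ p ─ q → x ∉ q
x∈p─q⇒x∉q (s ∷ p) (false ∷ q) {zero}  x∈ ()
x∈p─q⇒x∉q (s ∷ p) (true ∷ q)  {zero}  () x∈q
x∈p─q⇒x∉q (s ∷ p) (t ∷ q)     {suc x} (there x∈) (there x∈q) = x∈p─q⇒x∉q p q x∈ x∈q

─-monoˡ : ∀ {m} {p q : Subset m} (r : Subset m) → p ⊆ q → p ─ r ⊆ q ─ r
─-monoˡ {p = p} r p⊆q x∈ = x∈p∧x∉q⇒x∈p─q (p⊆q (p─q⊆p p r x∈)) (x∈p─q⇒x∉q p r x∈)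

subsetToFin : ∀ {k} → Subset k → Fin (2 ^ k)
subsetToFin S = funToFin (Inverse.from 2↔Bool ∘ lookup S)

finToSubset : ∀ {k} → Fin (2 ^ k) → Subset k
finToSubset i = tabulate (Inverse.to 2↔Bool ∘ finToFun i)

finToSubset-subsetToFin : ∀ {k} (S : Subset k) → finToSubset (subsetToFin S) ≡ S
finToSubset-subsetToFin S = trans
  (tabulate-cong (λ x → trans
    (cong (Inverse.to 2↔Bool) (finToFun-funToFin (Inverse.from 2↔Bool ∘ lookup S) x))
    (Inverse.strictlyInverseˡ 2↔Bool (lookup S x))))
  (tabulate∘lookup S)

stateToFin : ∀ {n k} → Fin n × Subset k → Fin (n * 2 ^ k)
stateToFin (v , S) = combine v (subsetToFin S)

finToState : ∀ {n k} → Fin (n * 2 ^ k) → Fin n × Subset k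
finToState {k = k} = map₂ finToSubset ∘ remQuot (2 ^ k)

finToState-stateToFin : ∀ {n k} (s : Fin n × Subset k) → finToState (stateToFin s) ≡ s
finToState-stateToFin (v , S) = trans
  (cong (map₂ finToSubset) (remQuot-combine v (subsetToFin S)))
  (cong (v ,_) (finToSubset-subsetToFin S))

-- The code of ⊥ is removed with punchOut, so `code ⊥` is a junk value.
nonemptyCode : ∀ {k m} → 2 ^ k ≡ m → 2 ≤ m →
  Σ[ code ∈ (Subset k → Fin (m ∸ 1)) ] Σ[ decode ∈ (Fin (m ∸ 1) → Subset k) ]
    (∀ S → Nonempty S → decode (code S) ≡ S)
nonemptyCode {k} {suc (suc m)} eq (s≤s (s≤s z≤n)) = code , decode , decode-code
  where
  toF : Subset k → Fin (suc (suc m))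
  toF S = subst Fin eq (subsetToFin S)

  fromF : Fin (suc (suc m)) → Subset k
  fromF i = finToSubset (subst Fin (sym eq) i)

  fromF-toF : ∀ S → fromF (toF S) ≡ S
  fromF-toF S = trans (cong finToSubset (subst-sym-subst eq)) (finToSubset-subsetToFin S)

  decode : Fin (suc m) → Subset k
  decode i = fromF (punchIn (toF ⊥) i)

  code : Subset k → Fin (suc m)
  code S with toF ⊥ ≟ toF S
  ... | yes _ = zero
  ... | no ≢  = punchOut ≢

  decode-code : ∀ S → Nonempty S → decode (code S) ≡ S
  decode-code S (x , x∈S) with toF ⊥ ≟ toF S
  ... | yes e = contradiction
    (subst (x ∈_) (trans (sym (fromF-toF S)) (trans (cong fromF (sym e)) (fromF-toF ⊥))) x∈S) ∉⊥
  ... | no ≢  = trans (cong fromF (punchIn-punchOut ≢)) (fromF-toF S)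

-- Each unstable stage strictly enlarges a subset of a finite set, so the search for a stable one
-- ends.
stabilises : ∀ {m} (P : ℕ → Fin m → Set) → (∀ j → Decidable (P j)) → (∀ j {x} → P j x → P (suc j) x) →
  ∃[ j ] (∀ x → P (suc j) x → P j x)
stabilises P P? mono = go 0 (⊃-wellFounded _)
  where
  go : ∀ j → Acc _⊃_ (setOf (P? j)) → ∃[ i ] (∀ x → P (suc i) x → P i x)
  go j (acc rs) with any? (λ x → P? (suc j) x ×-dec ¬? (P? j x))
  ... | no ∄ = j , λ x Px → decidable-stable (P? j x) (λ ¬Px → ∄ (x , Px , ¬Px))
  ... | yes (x , Px , ¬Px) = go (suc j) (rs
    ( (λ y∈ → ∈-setOf⁺ (P? (suc j)) (mono j (∈-setOf⁻ (P? j) y∈)))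
    , x , ∈-setOf⁺ (P? (suc j)) Px , ¬Px ∘ ∈-setOf⁻ (P? j)))

-- Passing to proper subsets that satisfy `P` ends at a minimal one, which is least because the sets
-- satisfying `P` form a chain.
least : ∀ {k} {P : Subset k → Set} → Decidable P → (∀ S T → P S → P T → S ⊆ T ⊎ T ⊆ S) →
  ∀ S → P S → ∃[ T ] P T × (∀ U → P U → T ⊆ U)
least {P = P} P? total S = go S (⊂-wellFounded S)
  where
  go : ∀ S → Acc _⊂_ S → P S → ∃[ T ] P T × (∀ U → P U → T ⊆ U)
  go S (acc rs) PS with anySubset? (λ T → P? T ×-dec T ⊂? S)
  ... | yes (T , PT , T⊂S) = go T (rs T⊂S) PT
  ... | no ∄ = S , PS , minimal
    where
    minimal : ∀ U → P U → S ⊆ U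
    minimal U PU {x} x∈S with total S U PS PU
    ... | inj₁ S⊆U = S⊆U x∈S
    ... | inj₂ U⊆S = decidable-stable (x ∈? U) (λ x∉U → ∄ (U , PU , U⊆S , x , x∈S , x∉U))

upperBound : ∀ {k} (f : Fin k → ℕ) → ∃[ b ] (∀ x → f x ≤ b)
upperBound {zero}  f = 0 , λ ()
upperBound {suc k} f with upperBound (f ∘ suc)
... | b , f≤b = f zero ⊔ b , λ { zero → m≤m⊔n _ b ; (suc x) → ≤-trans (f≤b x) (m≤n⊔m (f zero) b) }

-- Generalized reachability games

module _ {n : ℕ} (A : Arena n) where
  open Arena A

  -- Memory that is updated on leaving a vertex, so that its value on w · v depends on w only.
  module _ {M : Set} (m₀ : M) (leave : M → V → M) where

    leaveMemory : MemoryStructure A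
    leaveMemory = record { M = M ; m₀ = m₀ ; μ = λ { m (u , _) → leave m u } }

    module _ {p : Player} (ν : (v : V) → owner v ≡ p → M → ∃[ u ] Edge v u) where

      memoryStrategy : Strategy A p
      memoryStrategy = record
        { move  = λ w v own → proj₁ (ν v own (foldl leave m₀ w))
        ; legal = λ w v own → proj₂ (ν v own (foldl leave m₀ w))
        }

      μ*-leaveMemory : ∀ {w v} (π : Path A w v) → MemoryStructure.μ* leaveMemory π ≡ foldl leave m₀ w
      μ*-leaveMemory (start v) = refl
      μ*-leaveMemory (extend {w} {u} π e) =
        trans (cong (λ m → leave m u) (μ*-leaveMemory π)) (sym (foldl-∷ʳ leave m₀ u w))

      memoryStrategy-usesMemory : UsesMemory A memoryStrategy leaveMemory
      memoryStrategy-usesMemory = (λ v own m → proj₁ (ν v own m)) ,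
        λ π own → cong (proj₁ ∘ ν _ own) (sym (μ*-leaveMemory π))

  -- Attractor stages

  Edge? : ∀ u v → Dec (Edge u v)
  Edge? u v = v ∈? successors u

  -- Eve's one-step controllable predecessor, with `p` in the role of the owner of `v`.
  Pre : Player → V → (V → Set) → Set
  Pre Eve  v X = ∃[ u ] Edge v u × X u
  Pre Adam v X = ∀ u → Edge v u → X u

  pre? : ∀ p v {X} → Decidable X → Dec (Pre p v X)
  pre? Eve  v X? = any? (λ u → Edge? v u ×-dec X? u)
  pre? Adam v X? = all? (λ u → Edge? v u →-dec X? u)

  pre-mono : ∀ p v {X Y : V → Set} → (∀ {u} → X u → Y u) → Pre p v X → Pre p v Y
  pre-mono Eve  v f (u , e , x) = u , e , f x
  pre-mono Adam v f x u e = f (x u e)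

  module _ {k : ℕ} (F : Fin k → Subset n) where

    targetsAt : V → Subset k
    targetsAt v = setOf (λ x → v ∈? F x)

    -- A set paired with a vertex is always the one on arrival, before the targets at that vertex
    -- are crossed off.
    visit : Subset k → V → Subset k
    visit S v = S ─ targetsAt v

    visit-mono : ∀ {S T} v → S ⊆ T → visit S v ⊆ visit T v
    visit-mono v = ─-monoˡ (targetsAt v)

    -- Eve can visit all the targets in S within j moves, starting from v.
    Within : ℕ → V → Subset k → Set
    Within zero    v S = Empty (visit S v)
    Within (suc j) v S = Empty (visit S v) ⊎ Pre (owner v) v (λ u → Within j u (visit S v))

    within? : ∀ j v S → Dec (Within j v S)
    within? zero    v S = ¬? (nonempty? (visit S v))
    within? (suc j) v S = ¬? (nonempty? (visit S v)) ⊎-dec pre? (owner v) v (λ u → within? j u (visit S v))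

    within-pre : ∀ j {v p S} → owner v ≡ p → Pre p v (λ u → Within j u (visit S v)) → Within (suc j) v S
    within-pre j refl = inj₂

    pre-within : ∀ j {v p S} → owner v ≡ p → Within (suc j) v S → Nonempty (visit S v) →
      Pre p v (λ u → Within j u (visit S v))
    pre-within j refl (inj₁ ∅) ne = contradiction ne ∅
    pre-within j refl (inj₂ p) ne = p

    within-suc : ∀ j v S → Within j v S → Within (suc j) v S
    within-suc zero    v S e        = inj₁ e
    within-suc (suc j) v S (inj₁ e) = inj₁ e
    within-suc (suc j) v S (inj₂ p) = inj₂ (pre-mono (owner v) v (λ {u} → within-suc j u _) p)

    within-≤ : ∀ {i} j {v S} → i ≤ j → Within i v S → Within j v S
    within-≤ zero    z≤n w = w
    within-≤ (suc j) i≤1+j w with m≤n⇒m<n∨m≡n i≤1+j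
    ... | inj₁ (s≤s i≤j) = within-suc j _ _ (within-≤ j i≤j w)
    ... | inj₂ refl      = w

    within-antitone : ∀ j v {S T} → S ⊆ T → Within j v T → Within j v S
    within-antitone zero    v S⊆T e        = λ { (x , x∈) → e (x , visit-mono v S⊆T x∈) }
    within-antitone (suc j) v S⊆T (inj₁ e) = inj₁ λ { (x , x∈) → e (x , visit-mono v S⊆T x∈) }
    within-antitone (suc j) v S⊆T (inj₂ p) =
      inj₂ (pre-mono (owner v) v (λ {u} → within-antitone j u (visit-mono v S⊆T)) p)

    within-stabilises : ∃[ j ] (∀ v S → Within (suc j) v S → Within j v S)
    within-stabilises =
      let j , stable = stabilises (λ j x → uncurry (Within j) (finToState x))
            (λ j x → uncurry (within? j) (finToState x)) (λ j {x} → uncurry (within-suc j) (finToState x))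
      in j , λ v S w → subst (uncurry (Within j)) (finToState-stateToFin (v , S))
           (stable (stateToFin (v , S)) (subst (uncurry (Within (suc j))) (sym (finToState-stateToFin (v , S))) w))

    -- Descends to the least stage containing the state and moves to the stage below, since a move
    -- chosen at a larger stage need not make progress. The `hasSuccessor` values are defaults.
    attract : ℕ → (v : V) → Subset k → ∃[ u ] Edge v u
    attract zero    v S = hasSuccessor v
    attract (suc j) v S with within? j v S | pre? Eve v (λ u → within? j u (visit S v))
    ... | yes _ | _                = attract j v S
    ... | no _  | yes (u , e , _)  = u , e
    ... | no _  | no _             = hasSuccessor v

    -- The least stage used by `attract` is at most any `j` that contains the state, so the move
    -- goes below every such `j`.
    attract-decreases : ∀ N {v S j} → owner v ≡ Eve → j ≤ N → Within j v S → Nonempty (visit S v) →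
      ∃[ i ] i < j × Within i (proj₁ (attract N v S)) (visit S v)
    attract-decreases zero own z≤n w ne = contradiction ne w
    attract-decreases (suc N) {v} {S} {j} own j≤ w ne
      with within? N v S | pre? Eve v (λ u → within? N u (visit S v)) | m≤n⇒m<n∨m≡n j≤
    ... | yes _  | _                | inj₁ (s≤s j≤N) = attract-decreases N own j≤N w ne
    ... | yes w′ | _                | inj₂ refl
        = let i , i<N , w″ = attract-decreases N own ≤-refl w′ ne in i , m≤n⇒m≤1+n i<N , w″
    ... | no ¬w  | _                | inj₁ (s≤s j≤N) = contradiction (within-≤ N j≤N w) ¬w
    ... | no _   | yes (u , e , w′) | inj₂ refl      = N , ≤-refl , w′
    ... | no _   | no ¬p            | inj₂ refl = contradiction (pre-within N own w ne) ¬p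

    -- Remaining targets along a play

    module _ (v₀ : V) where

      module OnPlay (σ : Strategy A Eve) (τ : Strategy A Adam) where

        prefix : ℕ → List V
        prefix i = proj₁ (history A v₀ σ τ i)

        vertex : ℕ → V
        vertex i = proj₂ (history A v₀ σ τ i)

        remaining : ℕ → Subset k
        remaining i = foldl visit ⊤ (prefix i)

        remaining-suc : ∀ i → remaining (suc i) ≡ visit (remaining i) (vertex i)
        remaining-suc i = foldl-∷ʳ visit ⊤ (vertex i) (prefix i)

        visited : ∀ i {x} → x ∉ remaining i → ∃[ j ] vertex j ∈ F x
        visited zero    x∉ = contradiction ∈⊤ x∉
        visited (suc i) {x} x∉ with x ∈? remaining i | vertex i ∈? F x
        ... | no x∉′  | _       = visited i x∉′
        ... | yes _   | yes v∈  = i , v∈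
        ... | yes x∈  | no v∉   = contradiction
          (subst (x ∈_) (sym (remaining-suc i)) (x∈p∧x∉q⇒x∈p─q x∈ (v∉ ∘ ∈-setOf⁻ (λ y → vertex i ∈? F y)))) x∉

        remaining⇒unvisited : ∀ i {x} → x ∈ remaining i → ∀ j → j < i → vertex j ∉ F x
        remaining⇒unvisited (suc i) {x} x∈ j (s≤s j≤i) v∈
          with subst (x ∈_) (remaining-suc i) x∈ | m≤n⇒m<n∨m≡n j≤i
        ... | x∈′ | inj₁ j<i  = remaining⇒unvisited i (p─q⊆p (remaining i) _ x∈′) j j<i v∈
        ... | x∈′ | inj₂ refl = x∈p─q⇒x∉q (remaining i) _ x∈′ (∈-setOf⁺ (λ y → vertex i ∈? F y) v∈)

        done⇒genReach : ∀ i → Empty (remaining i) → GenReach A F (play A v₀ σ τ)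
        done⇒genReach i ∅ x = visited i (λ x∈ → ∅ (x , x∈))

        neverDone⇒¬genReach : (∀ i → Nonempty (remaining i)) → ¬ GenReach A F (play A v₀ σ τ)
        neverDone⇒¬genReach ne reach with upperBound (proj₁ ∘ reach)
        -- All targets are visited by time `b`. The set at `suc b` is the first to take the vertex
        -- at time `b` into account.
        ... | b , ≤b with ne (suc b)
        ... | x , x∈ = remaining⇒unvisited (suc b) x∈ (proj₁ (reach x)) (s≤s (≤b x)) (proj₂ (reach x))

      -- Eve's strategy

      module EveWins {M : Set} (code : Subset k → M) (decode : M → Subset k)
        (decode-code : ∀ S → Nonempty S → decode (code S) ≡ S) (N : ℕ) where

        m₀ : M
        m₀ = code ⊤

        leave : M → V → M
        leave m v = code (visit (decode m) v)

        ν : (v : V) → owner v ≡ Eve → M → ∃[ u ] Edge v u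
        ν v own m = attract N v (decode m)

        σ : Strategy A Eve
        σ = memoryStrategy m₀ leave ν

        module _ (τ : Strategy A Adam) where
          open OnPlay σ τ

          memory : ℕ → M
          memory i = foldl leave m₀ (prefix i)

          -- The owner is a variable `p`, so that `choice` reduces by cases on the player to move.
          step : ∀ {j} w v p (own : owner v ≡ p) → j ≤ N → let S = decode (foldl leave m₀ w) in
            Within j v S → Nonempty (visit S v) →
            ∃[ i ] i < j × Within i (proj₁ (choice A v₀ σ τ w v p own)) (visit S v)
          step {j}     w v Eve  own j≤N wi ne = attract-decreases N own j≤N wi ne
          step {zero}  w v Adam own j≤N wi ne = contradiction ne wi
          step {suc j} w v Adam own j≤N wi ne =
            j , ≤-refl , pre-within j own wi ne _ (Strategy.legal τ w v own)

          eventuallyDone : ∀ j → Acc _<_ j → ∀ i → j ≤ N → decode (memory i) ≡ remaining i →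
            Within j (vertex i) (remaining i) → ∃[ i′ ] Empty (remaining i′)
          eventuallyDone j (acc rs) i j≤N m≡ wi with nonempty? (visit (remaining i) (vertex i))
          -- Every target is visited once `vertex i` counts, so the play is won before the junk code
          -- of `⊥` could mislead Eve.
          ... | no ∅ = suc i , subst Empty (sym (remaining-suc i)) ∅
          ... | yes ne with step (prefix i) (vertex i) _ refl j≤N
                (subst (Within j (vertex i)) (sym m≡) wi) (subst (λ S → Nonempty (visit S (vertex i))) (sym m≡) ne)
          ... | j′ , j′<j , wi′ = eventuallyDone j′ (rs j′<j) (suc i) (≤-trans (<⇒≤ j′<j) j≤N) m≡′
                (subst (Within j′ (vertex (suc i))) r≡ wi′)
            where
            r≡ : visit (decode (memory i)) (vertex i) ≡ remaining (suc i)
            r≡ = trans (cong (λ S → visit S (vertex i)) m≡) (sym (remaining-suc i))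

            m≡′ : decode (memory (suc i)) ≡ remaining (suc i)
            m≡′ = trans (cong decode (foldl-∷ʳ leave m₀ (vertex i) (prefix i)))
              (trans (decode-code _ (subst (λ S → Nonempty (visit S (vertex i))) (sym m≡) ne)) r≡)

          wins : Nonempty {k} ⊤ → Within N v₀ ⊤ → GenReach A F (play A v₀ σ τ)
          wins ne w = let i , ∅ = eventuallyDone N (<-wellFounded N) 0 ≤-refl (decode-code ⊤ ne) w
                      in done⇒genReach i ∅

      -- Adam's strategy

      module AdamWins {m : ℕ} (chain : Subset k → Fin m)
        (chain-total : ∀ S T → chain S ≡ chain T → S ⊆ T ⊎ T ⊆ S)
        (N : ℕ) (stable : ∀ v S → Within (suc N) v S → Within N v S) where

        Escapes : V → Subset k → Set
        Escapes v S = ¬ Within N v S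

        Candidate : V → Fin m → Subset k → Set
        Candidate v c S = chain S ≡ c × Escapes v S

        candidate? : ∀ v c → Decidable (Candidate v c)
        candidate? v c S = (chain S ≟ c) ×-dec ¬? (within? N v S)

        candidates-total : ∀ v c S T → Candidate v c S → Candidate v c T → S ⊆ T ⊎ T ⊆ S
        candidates-total v c S T (eqS , _) (eqT , _) = chain-total S T (trans eqS (sym eqT))

        belief : V → Fin m → Subset k
        belief v c with anySubset? (candidate? v c)
        ... | yes (S , cand) = proj₁ (least (candidate? v c) (candidates-total v c) S cand)
        -- A default; `belief-least` excludes this case when the chain has a candidate at `v`.
        ... | no _           = ⊤

        belief-least : ∀ v c S → Candidate v c S → Escapes v (belief v c) × belief v c ⊆ S
        belief-least v c S cand with anySubset? (candidate? v c)
        ... | no ∄           = contradiction (S , cand) ∄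
        ... | yes (T , cand′) with least (candidate? v c) (candidates-total v c) T cand′
        ... | U , (_ , esc) , U⊆ = esc , U⊆ S cand

        -- Keeps only the chain of the updated belief; on arrival at the next vertex the belief
        -- drops to the least candidate there.
        leave : Fin m → V → Fin m
        leave c v = chain (visit (belief v c) v)

        ν : (v : V) → owner v ≡ Adam → Fin m → ∃[ u ] Edge v u
        ν v own c with any? (λ u → Edge? v u ×-dec ¬? (within? N u (visit (belief v c) v)))
        ... | yes (u , e , _) = u , e
        ... | no _            = hasSuccessor v

        -- If all successors were within `N` moves, `v` would be within `suc N`, hence by stability
        -- within `N`.
        ν-escapes : ∀ v own c → Escapes v (belief v c) → Escapes (proj₁ (ν v own c)) (visit (belief v c) v)
        ν-escapes v own c esc with any? (λ u → Edge? v u ×-dec ¬? (within? N u (visit (belief v c) v)))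
        ... | yes (u , e , ¬w) = ¬w
        ... | no ∄ = contradiction
          (stable v (belief v c) (within-pre N own
            (λ u e → decidable-stable (within? N u _) (λ ¬w → ∄ (u , e , ¬w)))))
          esc

        τ : Strategy A Adam
        τ = memoryStrategy (chain ⊤) leave ν

        module _ (σ : Strategy A Eve) where
          open OnPlay σ τ

          memory : ℕ → Fin m
          memory i = foldl leave (chain ⊤) (prefix i)

          believed : ℕ → Subset k
          believed i = belief (vertex i) (memory i)

          step : ∀ w v p (own : owner v ≡ p) → let S = belief v (foldl leave (chain ⊤) w) in
            Escapes v S → Escapes (proj₁ (choice A v₀ σ τ w v p own)) (visit S v)
          step w v Adam own esc   = ν-escapes v own _ esc
          step w v Eve  own esc w∈ = esc (stable v _ (within-pre N own (_ , Strategy.legal σ w v own , w∈)))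

          -- Visiting is monotone and taking the least candidate only shrinks the belief, so it
          -- stays below the true remaining set.
          invariant : Escapes v₀ ⊤ → ∀ i → Escapes (vertex i) (believed i) × believed i ⊆ remaining i
          invariant esc₀ zero    = belief-least v₀ (chain ⊤) ⊤ (refl , esc₀)
          invariant esc₀ (suc i) with invariant esc₀ i
          ... | esc , ⊆r with belief-least (vertex (suc i)) (memory (suc i)) (visit (believed i) (vertex i))
                 (sym (foldl-∷ʳ leave (chain ⊤) (vertex i) (prefix i)) , step (prefix i) (vertex i) _ refl esc)
          ... | esc′ , ⊆b = esc′ , subst (believed (suc i) ⊆_) (sym (remaining-suc i))
                 (⊆-trans ⊆b (visit-mono (vertex i) ⊆r))

          escapes⇒nonempty : ∀ v S → Escapes v S → Nonempty S
          escapes⇒nonempty v S esc = decidable-stable (nonempty? S)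
            (λ ∅ → esc (within-≤ N z≤n (λ { (x , x∈) → ∅ (x , p─q⊆p S _ x∈) })))

          wins : Escapes v₀ ⊤ → ¬ GenReach A F (play A v₀ σ τ)
          wins esc₀ = neverDone⇒¬genReach λ i →
            let esc , ⊆r = invariant esc₀ i ; x , x∈ = escapes⇒nonempty _ _ esc in x , ⊆r x∈

lemma1 : (k : ℕ) → 1 ≤ k → (n : ℕ) (A : Arena n) (F : Fin k → Subset n) (v₀ : Fin n) →
    (Wins (genReachGame A F) Eve v₀ → WinsWithMemory (genReachGame A F) Eve v₀ (2 ^ k ∸ 1)) ×
    (Wins (genReachGame A F) Adam v₀ → WinsWithMemory (genReachGame A F) Adam v₀ (k C ⌊ k /2⌋))
lemma1 (suc k) 1≤k n A F v₀
  with nonemptyCode {suc k} refl (^-monoʳ-≤ 2 1≤k) | chainDecomposition (suc k) | within-stabilises A F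
... | code , decode , decode-code | chain , chain-total | N , stable
  -- At the stable stage `N` this test decides the winner.
  with within? A F N v₀ ⊤
... | yes w =
    (λ _ → leaveMemory A m₀ leave , ↔-id _ , σ , σ-wins , memoryStrategy-usesMemory A m₀ leave ν)
  -- The two winning strategies would disagree on the play they produce together.
  , (λ (τ , τ-wins) → contradiction (σ-wins τ) (τ-wins σ))
  where
  open EveWins A F v₀ code decode decode-code N

  σ-wins : Winning (genReachGame A F) Eve v₀ σ
  -- With at least one target the initial set is nonempty, so its code is faithful.
  σ-wins τ = wins τ (zero , ∈⊤) w
... | no ¬w =
    (λ (σ , σ-wins) → contradiction (σ-wins τ) (τ-wins σ))
  , (λ _ → leaveMemory A (chain ⊤) leave , ↔-id _ , τ , τ-wins , memoryStrategy-usesMemory A (chain ⊤) leave ν)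
  where
  open AdamWins A F v₀ chain chain-total N stable

  τ-wins : Winning (genReachGame A F) Adam v₀ τ
  τ-wins σ = wins σ ¬w
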